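{- Let $k\ge1$ and let $q$ be a prime power with $q\equiv -1\pmod 4$ and $q>(2^{2k+1})^2$. Then the Paley tournament $PT_q$ has no transitive $k$-coloring.
   Context: The Paley tournament $PT_q$ has vertex set $GF(q)$, and $xy$ is an edge iff $y-x$ is a nonzero square in $GF(q)$. A transitive $k$-coloring of a tournament is an edge coloring with colors $1,\dots,k$ such that for each color $i$ the digraph of edges of color $i$ is transitive (whenever $ab,bc$ have color $i$, $ac$ is an edge of color $i$). -}

module Defs where

open import Data.Nat using (ℕ; _≤_; _^_)
open import Data.Nat.Primality using (Prime)
open import Data.Fin using (Fin)
open import Data.Product using (_×_; ∃; Σ)
open import Relation.Binary.PropositionalEquality using (_≡_; _≢_)
open import Algebra.Core using (Op₁; Op₂)
open import Algebra.Structures using (IsCommutativeRing)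
open import Function.Bundles using (_↔_)

IsPrimePower : ℕ → Set
IsPrimePower q = ∃ λ p → ∃ λ e → Prime p × 1 ≤ e × q ≡ p ^ e

-- A finite field with exactly q elements (equality is propositional equality).
-- Any such field is (isomorphic to) GF(q).
record FiniteField (q : ℕ) : Set₁ where
  field
    Carrier : Set
    _+_ : Op₂ Carrier
    _*_ : Op₂ Carrier
    -_  : Op₁ Carrier
    0#  : Carrier
    1#  : Carrier
    isCommutativeRing : IsCommutativeRing _≡_ _+_ _*_ -_ 0# 1#
    0≢1 : 0# ≢ 1#
    inverse : ∀ x → x ≢ 0# → ∃ λ y → x * y ≡ 1#
    enumeration : Carrier ↔ Fin q

module _ {q : ℕ} (F : FiniteField q) where
  open FiniteField F

  IsNonzeroSquare : Carrier → Set
  IsNonzeroSquare a = a ≢ 0# × ∃ λ s → s * s ≡ a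

  PaleyEdge : Carrier → Carrier → Set
  PaleyEdge x y = IsNonzeroSquare (y + (- x))

  -- A colouring col assigns a colour in Fin k to each ordered pair; only its
  -- values on edges of PT_q matter. It is a transitive k-colouring if for every
  -- colour i, whenever ab and bc are edges of colour i, then ac is an edge of colour i.
  IsTransitiveColoring : (k : ℕ) → (Carrier → Carrier → Fin k) → Set
  IsTransitiveColoring k col =
    ∀ a b c (i : Fin k) →
      PaleyEdge a b → PaleyEdge b c → col a b ≡ i → col b c ≡ i →
      PaleyEdge a c × col a c ≡ i

  HasTransitiveColoring : ℕ → Set
  HasTransitiveColoring k = Σ (Carrier → Carrier → Fin k) (IsTransitiveColoring k)

{-# OPTIONS --safe #-}
-- Let χ be the quadratic character of GF(q). Since Σₓ χ(b - x)χ(b′ - x) is q - 1 for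
-- b = b′ and -1 otherwise, Σₓ (Σ_{b∈B} χ(b - x))² = q|B| - |B|²; hence if every pair in
-- A × B is an edge of PT_q then |A||B|² ≤ q|B|. In a transitive colouring, for every vertex v
-- and colour i all of N_i⁻(v) points to all of N_i⁺(v), so one of the two has at most
-- t = ⌊√q⌋ elements. Passing k times to the larger half yields a set T of at least q / 2ᵏ
-- vertices on which the small side of each colour is constant. Counting the edges inside T
-- colour by colour gives |T|² ≤ |T| + 2kt|T|, whence t ≤ 2ᵏ(2k + 1) < 2^(2k+1) ≤ t.
module Submission where

open import Defs
open import Algebra.Bundles using (CommutativeMonoid; CommutativeRing; Semiring)
import Algebra.Properties.CommutativeMonoid.Sum as MonoidSum
import Algebra.Properties.CommutativeSemigroup as CommutativeSemigroupProperties
import Algebra.Properties.CommutativeSemiring.Exp as Exp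
import Algebra.Properties.Monoid.Mult as Mult
import Algebra.Properties.Ring as RingProperties
import Algebra.Properties.Semiring.Sum as SemiringSum
open import Data.Bool using (Bool; true; false; if_then_else_; _∧_; not)
open import Data.Fin using (Fin; zero; suc)
import Data.Fin.Properties as Fin
open import Data.Nat as ℕ using (ℕ; zero; suc)
open import Data.Nat.DivMod using (m≡m%n+[m/n]*n)
import Data.Nat.Properties as ℕ
open import Data.Nat.Tactic.RingSolver using (solve-∀)
open import Data.Product using (_×_; _,_; ∃; proj₁; proj₂)
open import Data.Sum using (_⊎_; inj₁; inj₂)
open import Function using (_∘_; flip; mk↔ₛ′)
open import Function.Bundles using (Inverse; _↔_)
open import Function.Construct.Composition using (_↔-∘_)
open import Function.Construct.Symmetry using (↔-sym)
open import Function.Properties.Inverse using (↔⇒↣)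
open import Relation.Binary.PropositionalEquality
open import Relation.Nullary using (¬_; Dec; yes; no; does; contradiction; _×-dec_)
open import Relation.Nullary.Decidable using (dec-true; via-injection)

-- Finite sums and counting in subsets of `Fin n`.

module Counting where

  open import Data.Nat hiding (zero; suc; _≟_)
  open import Data.Nat.Properties hiding (_≟_)

  module ℕΣ = SemiringSum +-*-semiring
  open ℕΣ using (sum)

  module _ {a ℓ} (M : CommutativeMonoid a ℓ) where
    open CommutativeMonoid M using (Carrier; _≈_; ε; ∙-congˡ; identityʳ) renaming (trans to ≈-trans)
    open MonoidSum M using (sum-remove; sum-cong-≋; sum-replicate-zero) renaming (sum to sumᴹ)

    sum-single : ∀ {n} (f : Fin n → Carrier) i → (∀ j → j ≢ i → f j ≈ ε) → sumᴹ f ≈ f i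
    sum-single {suc n} f i f≈ε = ≈-trans (sum-remove {i = i} f) (≈-trans
      (∙-congˡ (≈-trans (sum-cong-≋ λ j → f≈ε _ (Fin.punchInᵢ≢i i j)) (sum-replicate-zero n)))
      (identityʳ (f i)))

  sum-mono-≤ : ∀ {n} {f g : Fin n → ℕ} → (∀ i → f i ≤ g i) → sum f ≤ sum g
  sum-mono-≤ {zero}  f≤g = z≤n
  sum-mono-≤ {suc n} f≤g = +-mono-≤ (f≤g zero) (sum-mono-≤ (f≤g ∘ suc))

  sum-const : ∀ n c → sum {n} (λ _ → c) ≡ n * c
  sum-const zero    c = refl
  sum-const (suc n) c = cong (c +_) (sum-const n c)

  term≤sum : ∀ {n} (f : Fin n → ℕ) i → f i ≤ sum f
  term≤sum f zero    = m≤m+n _ _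
  term≤sum f (suc i) = ≤-trans (term≤sum (f ∘ suc) i) (m≤n+m _ (f zero))

  ⟦_⟧ : Bool → ℕ
  ⟦ b ⟧ = if b then 1 else 0

  count : ∀ {n} → (Fin n → Bool) → ℕ
  count S = sum (⟦_⟧ ∘ S)

  infix 4 _⊩_
  _⊩_ : ∀ {n} → (Fin n → Bool) → (Fin n → Set) → Set
  S ⊩ P = ∀ v → S v ≡ true → P v

  half : ∀ {m} a b → m ≡ a + b → m ≤ 2 * a ⊎ m ≤ 2 * b
  half a b refl with ≤-total a b
  ... | inj₁ a≤b = inj₂ (+-mono-≤ a≤b (m≤m+n b 0))
  ... | inj₂ b≤a = inj₁ (+-monoʳ-≤ a (≤-trans b≤a (m≤m+n a 0)))

  -- The disjunct returned by `P⊎Q v` splits `S` in two, and the larger part is kept. Containment in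
  -- `S` is recorded so that properties of `S` survive further halvings.
  halving : ∀ {n} {P Q : Fin n → Set} → (∀ v → P v ⊎ Q v) → (S : Fin n → Bool) →
            ∃ λ T → count S ≤ 2 * count T × (T ⊩ P ⊎ T ⊩ Q) × T ⊩ (λ v → S v ≡ true)
  halving {P = P} {Q} P⊎Q S = pick (half (count T₁) (count T₂) count-split)
    where
    left : ∀ {v} → P v ⊎ Q v → Bool
    left (inj₁ _) = true
    left (inj₂ _) = false
    T₁ T₂ : _ → Bool
    T₁ v = S v ∧ left (P⊎Q v)
    T₂ v = S v ∧ not (left (P⊎Q v))
    ⟦⟧-split : ∀ a b → ⟦ a ⟧ ≡ ⟦ a ∧ b ⟧ + ⟦ a ∧ not b ⟧
    ⟦⟧-split false b     = refl
    ⟦⟧-split true  false = refl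
    ⟦⟧-split true  true  = refl
    count-split : count S ≡ count T₁ + count T₂
    count-split = trans (ℕΣ.sum-cong-≗ λ v → ⟦⟧-split (S v) (left (P⊎Q v)))
                        (ℕΣ.∑-distrib-+ (⟦_⟧ ∘ T₁) (⟦_⟧ ∘ T₂))
    T₁-P : T₁ ⊩ P
    T₁-P v e with S v | P⊎Q v
    T₁-P v e  | true  | inj₁ p = p
    T₁-P v () | true  | inj₂ _
    T₁-P v () | false | _
    T₂-Q : T₂ ⊩ Q
    T₂-Q v e with S v | P⊎Q v
    T₂-Q v e  | true  | inj₂ q = q
    T₂-Q v () | true  | inj₁ _
    T₂-Q v () | false | _
    ∧-true : ∀ {a b} → a ∧ b ≡ true → a ≡ true
    ∧-true {true} _ = refl
    pick : count S ≤ 2 * count T₁ ⊎ count S ≤ 2 * count T₂ → _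
    pick (inj₁ le) = T₁ , le , inj₁ T₁-P , λ _ → ∧-true
    pick (inj₂ le) = T₂ , le , inj₂ T₂-Q , λ _ → ∧-true

  -- Induction on `k`: each index costs one halving, and shrinking the set keeps the alternatives
  -- already settled for the other indices.
  homogeneous-subset : ∀ {n} k {P Q : Fin k → Fin n → Set} → (∀ i v → P i v ⊎ Q i v) →
                       ∃ λ T → n ≤ 2 ^ k * count T × (∀ i → T ⊩ P i ⊎ T ⊩ Q i)
  homogeneous-subset {n} zero P⊎Q = (λ _ → true) , ≤-reflexive n≡ , λ ()
    where
    n≡ : n ≡ 1 * count {n} (λ _ → true)
    n≡ = sym (trans (*-identityˡ _) (trans (sum-const n 1) (*-identityʳ n)))
  homogeneous-subset {n} (suc k) {P} {Q} P⊎Q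
    with homogeneous-subset k (P⊎Q ∘ suc)
  ... | S , n≤S , S-hom with halving (P⊎Q zero) S
  ... | T , S≤T , T-hom , T⊆S = T , n≤T , hom
    where
    open ≤-Reasoning
    n≤T : n ≤ 2 ^ suc k * count T
    n≤T = begin
      n                       ≤⟨ n≤S ⟩
      2 ^ k * count S         ≤⟨ *-monoʳ-≤ (2 ^ k) S≤T ⟩
      2 ^ k * (2 * count T)   ≡⟨ *-assoc (2 ^ k) 2 (count T) ⟨
      2 ^ k * 2 * count T     ≡⟨ cong (_* count T) (*-comm (2 ^ k) 2) ⟩
      2 ^ suc k * count T     ∎
    restrict : ∀ {R : Fin n → Set} → S ⊩ R → T ⊩ R
    restrict S⊩R v Tv = S⊩R v (T⊆S v Tv)
    hom : ∀ i → T ⊩ P i ⊎ T ⊩ Q i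
    hom zero    = T-hom
    hom (suc i) with S-hom i
    ... | inj₁ p = inj₁ (restrict p)
    ... | inj₂ q = inj₂ (restrict q)

  -- Weighted sums over ordered pairs inside a vertex set.

  module PairSum {n} (T : Fin n → Bool) where

    τ : Fin n → ℕ
    τ v = ⟦ T v ⟧

    -- The 0-1 weights cut the sum down to `T × T` while both indices keep running over all of
    -- `Fin n`, so interchange and distributivity apply without reindexing.
    pairSum : (Fin n → Fin n → ℕ) → ℕ
    pairSum c = sum λ u → sum λ v → τ u * τ v * c u v

    pairSum-mono : ∀ {c d} → (∀ u v → c u v ≤ d u v) → pairSum c ≤ pairSum d
    pairSum-mono c≤d = sum-mono-≤ λ u → sum-mono-≤ λ v → *-monoʳ-≤ (τ u * τ v) (c≤d u v)

    pairSum-+ : ∀ c d → pairSum (λ u v → c u v + d u v) ≡ pairSum c + pairSum d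
    pairSum-+ c d = trans
      (ℕΣ.sum-cong-≗ λ u → trans
        (ℕΣ.sum-cong-≗ λ v → *-distribˡ-+ (τ u * τ v) (c u v) (d u v))
        (ℕΣ.∑-distrib-+ (λ v → τ u * τ v * c u v) (λ v → τ u * τ v * d u v)))
      (ℕΣ.∑-distrib-+ (λ u → sum λ v → τ u * τ v * c u v) (λ u → sum λ v → τ u * τ v * d u v))

    pairSum-flip : ∀ c → pairSum (flip c) ≡ pairSum c
    pairSum-flip c = trans (ℕΣ.∑-comm (λ u v → τ u * τ v * c v u))
      (ℕΣ.sum-cong-≗ λ v → ℕΣ.sum-cong-≗ λ u → cong (_* c v u) (*-comm (τ u) (τ v)))

    pairSum-1 : pairSum (λ _ _ → 1) ≡ count T * count T
    pairSum-1 = sym (trans (ℕΣ.*-distribʳ-sum (count T) τ)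
      (ℕΣ.sum-cong-≗ λ u → trans (ℕΣ.*-distribˡ-sum (τ u) τ)
        (ℕΣ.sum-cong-≗ λ v → sym (*-identityʳ (τ u * τ v)))))

    -- Only rows with `u` in `T` carry weight, and replacing `τ v` by 1 in such a row leaves at most
    -- the full row sum.
    pairSum-rows : ∀ {t} c → T ⊩ (λ u → sum (c u) ≤ t) → pairSum c ≤ count T * t
    pairSum-rows {t} c rows = begin
      pairSum c                 ≤⟨ sum-mono-≤ row ⟩
      sum (λ u → τ u * t)       ≡⟨ ℕΣ.*-distribʳ-sum t τ ⟨
      count T * t               ∎
      where
      open ≤-Reasoning
      τ≤1 : ∀ v → τ v ≤ 1
      τ≤1 v with T v
      ... | true  = ≤-refl
      ... | false = z≤n
      scaled : ∀ u → τ u * sum (c u) ≤ τ u * t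
      scaled u with T u in Tu
      ... | true  = *-monoʳ-≤ 1 (rows u Tu)
      ... | false = z≤n
      row : ∀ u → sum (λ v → τ u * τ v * c u v) ≤ τ u * t
      row u = begin
        sum (λ v → τ u * τ v * c u v)  ≤⟨ sum-mono-≤ (λ v → *-monoˡ-≤ (c u v)
                                          (≤-trans (*-monoʳ-≤ (τ u) (τ≤1 v)) (≤-reflexive (*-identityʳ (τ u))))) ⟩
        sum (λ v → τ u * c u v)        ≡⟨ ℕΣ.*-distribˡ-sum (τ u) (c u) ⟨
        τ u * sum (c u)                ≤⟨ scaled u ⟩
        τ u * t                        ∎

    pairSum-sum : ∀ {k b} (c : Fin k → Fin n → Fin n → ℕ) → (∀ i → pairSum (c i) ≤ b) →
                  pairSum (λ u v → sum λ i → c i u v) ≤ k * b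
    pairSum-sum {zero}  c c≤b = pairSum-0
      where
      pairSum-0 : pairSum (λ _ _ → 0) ≤ 0
      pairSum-0 = ≤-trans (pairSum-rows {0} (λ _ _ → 0)
        (λ _ _ → ≤-reflexive (trans (sum-const n 0) (*-zeroʳ n)))) (≤-reflexive (*-zeroʳ (count T)))
    pairSum-sum {suc k} c c≤b = ≤-trans
      (≤-reflexive (pairSum-+ (c zero) (λ u v → sum λ i → c (suc i) u v)))
      (+-mono-≤ (c≤b zero) (pairSum-sum (c ∘ suc) (c≤b ∘ suc)))

  -- Covering all pairs by sparse relations.

  δ : ∀ {n} → Fin n → Fin n → ℕ
  δ u v = ⟦ does (u Fin.≟ v) ⟧

  δ-refl : ∀ {n} (u : Fin n) → δ u u ≡ 1
  δ-refl u with u Fin.≟ u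
  ... | yes _  = refl
  ... | no u≢u with () ← u≢u refl

  δ-≢ : ∀ {n} {u v : Fin n} → u ≢ v → δ u v ≡ 0
  δ-≢ {u = u} {v} u≢v with u Fin.≟ v
  ... | yes u≡v with () ← u≢v u≡v
  ... | no _ = refl

  sum-δ : ∀ {n} (u : Fin n) → sum (δ u) ≡ 1
  sum-δ u = trans (sum-single +-0-commutativeMonoid (δ u) u (λ v v≢u → δ-≢ (v≢u ∘ sym))) (δ-refl u)

  -- `covers` puts each ordered pair on the diagonal or under some `c i` in one of its two
  -- directions. On a homogeneous set of size `s`, each `c i` has all its columns or all its rows
  -- bounded by `t`, so it contributes at most `s * t` per direction, and the diagonal at most `s`.
  sparse-cover : ∀ {n} k t (c : Fin k → Fin n → Fin n → ℕ) →
    (∀ u v → 1 ≤ δ u v + sum (λ i → c i u v + c i v u)) →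
    (∀ i v → sum (λ u → c i u v) ≤ t ⊎ sum (c i v) ≤ t) →
    ∃ λ s → n ≤ 2 ^ k * s × s * s ≤ s * 1 + k * (s * t + s * t)
  sparse-cover {n} k t c covers sparse with homogeneous-subset k sparse
  ... | T , n≤T , hom = s , n≤T , s²≤
    where
    open PairSum T
    open ≤-Reasoning
    s : ℕ
    s = count T
    δ-rows : T ⊩ λ u → sum (δ u) ≤ 1
    δ-rows u _ = ≤-reflexive (sum-δ u)
    one-way : ∀ i → pairSum (c i) ≤ s * t
    one-way i with hom i
    -- Bounded in-degrees are column sums of `c i`; transposing turns them into row sums.
    ... | inj₁ ins  = ≤-trans (≤-reflexive (sym (pairSum-flip (c i)))) (pairSum-rows (flip (c i)) ins)
    ... | inj₂ outs = pairSum-rows (c i) outs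
    two-way : ∀ i → pairSum (λ u v → c i u v + c i v u) ≤ s * t + s * t
    two-way i = begin
      pairSum (λ u v → c i u v + c i v u)     ≡⟨ pairSum-+ (c i) (flip (c i)) ⟩
      pairSum (c i) + pairSum (flip (c i))    ≡⟨ cong (pairSum (c i) +_) (pairSum-flip (c i)) ⟩
      pairSum (c i) + pairSum (c i)           ≤⟨ +-mono-≤ (one-way i) (one-way i) ⟩
      s * t + s * t                           ∎
    pairs : Fin n → Fin n → ℕ
    pairs u v = sum λ i → c i u v + c i v u
    s²≤ : s * s ≤ s * 1 + k * (s * t + s * t)
    s²≤ = begin
      s * s                                 ≡⟨ pairSum-1 ⟨
      pairSum (λ _ _ → 1)                   ≤⟨ pairSum-mono covers ⟩
      pairSum (λ u v → δ u v + pairs u v)   ≡⟨ pairSum-+ δ pairs ⟩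
      pairSum δ + pairSum pairs             ≤⟨ +-mono-≤ (pairSum-rows δ δ-rows)
                                                 (pairSum-sum (λ i u v → c i u v + c i v u) two-way) ⟩
      s * 1 + k * (s * t + s * t)           ∎

  -- Numerical estimates.

  floor-sqrt : ∀ q → ∃ λ t → t * t ≤ q × q < suc t * suc t
  floor-sqrt zero = 0 , z≤n , s≤s z≤n
  floor-sqrt (suc q) with floor-sqrt q
  ... | t , t²≤q , q<[1+t]² with suc q <? suc t * suc t
  ... | yes 1+q< = t , m≤n⇒m≤1+n t²≤q , 1+q<
  -- Read as `suc q ≤ suc t * suc t`, the old upper bound puts `suc q` strictly below the next
  -- square.
  ... | no  1+q≮ = suc t , ≮⇒≥ 1+q≮ , ≤-<-trans q<[1+t]² (*-mono-< (n<1+n (suc t)) (n<1+n (suc t)))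

  -- If both factors exceeded `t`, their product would be at least `suc t * suc t`, hence larger
  -- than `q`.
  small-factor : ∀ {t q} a b → q < suc t * suc t → a * b ≤ q → a ≤ t ⊎ b ≤ t
  small-factor {t} a b q< ab≤q with a ≤? t | b ≤? t
  ... | yes a≤t | _       = inj₁ a≤t
  ... | no _    | yes b≤t = inj₂ b≤t
  ... | no a≰t  | no b≰t  with () ← <-irrefl refl
    (<-≤-trans q< (≤-trans (*-mono-≤ (≰⇒> a≰t) (≰⇒> b≰t)) ab≤q))

  -- Raising `k` by one adds 2 on the left and doubles the right, whose previous value is at least
  -- 2.
  1+2k<2^[1+k] : ∀ {k} → 1 ≤ k → suc (2 * k) < 2 ^ suc k
  1+2k<2^[1+k] {suc zero} _ = ≤-refl
  1+2k<2^[1+k] {suc (suc k)} _ = begin-strict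
    suc (2 * suc (suc k))           ≡⟨ lem k ⟩
    suc (2 * suc k) + 2             <⟨ +-mono-<-≤ (1+2k<2^[1+k] {suc k} (s≤s z≤n))
                                                  (*-mono-≤ {2} {2} {1} ≤-refl (m^n>0 2 (suc k))) ⟩
    2 ^ suc (suc k) + 2 ^ suc (suc k) ≡⟨ cong (2 ^ suc (suc k) +_) (+-identityʳ _) ⟨
    2 ^ suc (suc (suc k))           ∎
    where
    open ≤-Reasoning
    lem : ∀ k → suc (2 * suc (suc k)) ≡ suc (2 * suc k) + 2
    lem = solve-∀

  no-sparse-class : ∀ {k q t s} → 1 ≤ k → (2 ^ (2 * k + 1)) ^ 2 < q →
    t * t ≤ q → q < suc t * suc t → q ≤ 2 ^ k * s → ¬ (s * s ≤ s * 1 + k * (s * t + s * t))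
  -- An empty class would force `q ≤ 0`.
  no-sparse-class {k} {q} {t} {zero} _ M²<q _ _ q≤ _ =
    <⇒≱ (≤-<-trans z≤n M²<q) (≤-trans q≤ (≤-reflexive (*-zeroʳ (2 ^ k))))
  no-sparse-class {k} {q} {t} {s@(suc _)} 1≤k M²<q t²≤q q<[1+t]² q≤ s²≤ = <-irrefl refl t<t
    where
    open ≤-Reasoning
    M : ℕ
    M = 2 ^ (2 * k + 1)
    -- If `t < M`, then `q < suc t * suc t ≤ M * M`, against the size assumption on `q`.
    M≤t : M ≤ t
    M≤t with M ≤? t
    ... | yes p = p
    ... | no M≰t with () ← <-irrefl refl (begin-strict
      q               <⟨ q<[1+t]² ⟩
      suc t * suc t   ≤⟨ *-mono-≤ (≰⇒> M≰t) (≰⇒> M≰t) ⟩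
      M * M           ≡⟨ cong (M *_) (*-identityʳ M) ⟨
      M ^ 2           <⟨ M²<q ⟩
      q               ∎)
    1≤t : 1 ≤ t
    1≤t = ≤-trans (m^n>0 2 (2 * k + 1)) M≤t
    s≤ : s ≤ suc (2 * k) * t
    s≤ = begin
      s                 ≤⟨ *-cancelˡ-≤ s (≤-trans s²≤ (≤-reflexive (factor k s t))) ⟩
      -- Since `1 ≤ t`, the diagonal term 1 is absorbed into one more multiple of `t`.
      1 + 2 * k * t     ≤⟨ +-monoˡ-≤ (2 * k * t) 1≤t ⟩
      suc (2 * k) * t   ∎
      where
      factor : ∀ k s t → s * 1 + k * (s * t + s * t) ≡ s * (1 + 2 * k * t)
      factor = solve-∀
    t≤ : t ≤ 2 ^ k * suc (2 * k)
    -- The bound on `s` is linear in `t`, so one factor `t` cancels from `t * t ≤ q`.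
    t≤ = *-cancelʳ-≤ t _ t {{>-nonZero 1≤t}} (begin
      t * t                         ≤⟨ t²≤q ⟩
      q                             ≤⟨ q≤ ⟩
      2 ^ k * s                     ≤⟨ *-monoʳ-≤ (2 ^ k) s≤ ⟩
      2 ^ k * (suc (2 * k) * t)     ≡⟨ *-assoc (2 ^ k) _ t ⟨
      2 ^ k * suc (2 * k) * t       ∎)
    exponent : ∀ k → k + suc k ≡ 2 * k + 1
    exponent = solve-∀
    t<t : t < t
    t<t = begin-strict
      t                       ≤⟨ t≤ ⟩
      -- The exponents `k` and `suc k` then add up to the exponent of `M`.
      2 ^ k * suc (2 * k)     <⟨ *-monoʳ-< (2 ^ k) {{>-nonZero (m^n>0 2 k)}} (1+2k<2^[1+k] 1≤k) ⟩
      2 ^ k * 2 ^ suc k       ≡⟨ ^-distribˡ-+-* 2 k (suc k) ⟨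
      2 ^ (k + suc k)         ≡⟨ cong (2 ^_) (exponent k) ⟩
      M                       ≤⟨ M≤t ⟩
      t                       ∎

open Counting using (module ℕΣ; module PairSum; sum-single; sum-const;
  term≤sum; ⟦_⟧; count; _⊩_; δ; δ-refl; δ-≢; sum-δ)

-- Sums over an enumerated type with values in a commutative monoid.

module Reindexed {q : ℕ} {A : Set} (enum : A ↔ Fin q) {ℓ} (M : CommutativeMonoid ℓ ℓ) where
  open CommutativeMonoid M using (Carrier; _≈_; ε)
  open MonoidSum M using (sum; sum-permute; sum-cong-≋)
  open Inverse enum using (to; from; strictlyInverseˡ; strictlyInverseʳ)
  open import Relation.Binary.Reasoning.Setoid (CommutativeMonoid.setoid M)

  Σᴬ : (A → Carrier) → Carrier
  Σᴬ f = sum (f ∘ from)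

  -- Conjugating `g` by the enumeration gives a permutation of `Fin q`, under which finite sums are
  -- invariant. All later changes of variable rest on this.
  Σᴬ-bijection : (f : A → Carrier) (g : A ↔ A) → Σᴬ (f ∘ Inverse.to g) ≈ Σᴬ f
  Σᴬ-bijection f g = begin
    Σᴬ (f ∘ Inverse.to g)  ≈⟨ sum-cong-≋ (λ i → CommutativeMonoid.reflexive M
                                (cong f (sym (strictlyInverseʳ (Inverse.to g (from i)))))) ⟩
    sum (f ∘ from ∘ Inverse.to π) ≈⟨ sum-permute (f ∘ from) π ⟨
    Σᴬ f                   ∎
    where
    π : Fin q ↔ Fin q
    π = enum ↔-∘ (g ↔-∘ ↔-sym enum)

  Σᴬ-single : (f : A → Carrier) (a : A) → (∀ x → x ≢ a → f x ≈ ε) → Σᴬ f ≈ f a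
  Σᴬ-single f a f≈ε = begin
    Σᴬ f           ≈⟨ sum-single M (f ∘ from) (to a) (λ j j≢ → f≈ε (from j)
                        λ e → j≢ (trans (sym (strictlyInverseˡ j)) (cong to e))) ⟩
    f (from (to a)) ≡⟨ cong f (strictlyInverseʳ a) ⟩
    f a            ∎

-- Arithmetic in a finite field.

module Field {q : ℕ} (F : FiniteField q) where

  ring : CommutativeRing _ _
  ring = record { isCommutativeRing = FiniteField.isCommutativeRing F }

  open CommutativeRing ring public
    using (Carrier; _+_; _*_; -_; _-_; 0#; 1#; +-comm; +-assoc; *-comm; *-assoc; +-identityˡ; +-identityʳ;
           *-identityˡ; *-identityʳ; zeroˡ; zeroʳ; distribˡ; distribʳ; -‿inverseˡ; -‿inverseʳ)
  open FiniteField F public using (0≢1; inverse; enumeration)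
  open RingProperties (CommutativeRing.ring ring) public
    using (-‿distribˡ-*; -‿distribʳ-*; -1*x≈-x; -0#≈0#; -‿involutive; x∙y⁻¹≈ε⇒x≈y;
      +-inverseˡ-unique; ⁻¹-anti-homo-//; //-rightDividesˡ;
      //-rightDividesʳ; +-cancelʳ)
  open Inverse enumeration public using (to; from; strictlyInverseˡ)
  open Exp (CommutativeRing.commutativeSemiring ring) using (_^_; ^-assocʳ; ^-distrib-*)
  open CommutativeSemigroupProperties (CommutativeRing.*-commutativeSemigroup ring)
    using () renaming (interchange to *-interchange)
  open ≡-Reasoning

  infix 4 _≟_
  _≟_ : (x y : Carrier) → Dec (x ≡ y)
  _≟_ = via-injection (↔⇒↣ enumeration) Fin._≟_

  -- Extended by 0 at 0, inversion is an involution of the whole field and can serve as a change of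
  -- variable in sums over all elements.
  inv : Carrier → Carrier
  inv x with x ≟ 0#
  ... | yes _  = 0#
  ... | no x≢0 = proj₁ (inverse x x≢0)

  inv-0 : inv 0# ≡ 0#
  inv-0 with 0# ≟ 0#
  ... | yes _  = refl
  ... | no 0≢0 = contradiction refl 0≢0

  *-inv : ∀ {x} → x ≢ 0# → x * inv x ≡ 1#
  *-inv {x} x≢0 with x ≟ 0#
  ... | yes x≡0 = contradiction x≡0 x≢0
  ... | no x≢0′ = proj₂ (inverse x x≢0′)

  *-cancelˡ : ∀ {x y z} → x ≢ 0# → x * y ≡ x * z → y ≡ z
  *-cancelˡ {x} {y} {z} x≢0 xy≡xz = begin
    y                ≡⟨ shape y ⟨
    inv x * (x * y)  ≡⟨ cong (inv x *_) xy≡xz ⟩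
    inv x * (x * z)  ≡⟨ shape z ⟩
    z                ∎
    where
    shape : ∀ w → inv x * (x * w) ≡ w
    shape w = begin
      inv x * (x * w)  ≡⟨ *-assoc (inv x) x w ⟨
      inv x * x * w    ≡⟨ cong (_* w) (trans (*-comm (inv x) x) (*-inv x≢0)) ⟩
      1# * w           ≡⟨ *-identityˡ w ⟩
      w                ∎

  *-≢0 : ∀ {x y} → x ≢ 0# → y ≢ 0# → x * y ≢ 0#
  *-≢0 {x} x≢0 y≢0 xy≡0 = y≢0 (*-cancelˡ x≢0 (trans xy≡0 (sym (zeroʳ x))))

  -‿≢0 : ∀ {x} → x ≢ 0# → - x ≢ 0#
  -‿≢0 {x} x≢0 -x≡0 = x≢0 (trans (sym (-‿involutive x)) (trans (cong -_ -x≡0) -0#≈0#))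

  inv-≢0 : ∀ {x} → x ≢ 0# → inv x ≢ 0#
  inv-≢0 {x} x≢0 e = 0≢1 (trans (sym (zeroʳ x)) (trans (cong (x *_) (sym e)) (*-inv x≢0)))

  inv-involutive : ∀ x → inv (inv x) ≡ x
  inv-involutive x = by-cases (x ≟ 0#)
    where
    by-cases : Dec (x ≡ 0#) → inv (inv x) ≡ x
    by-cases (yes refl) = trans (cong inv inv-0) inv-0
    by-cases (no x≢0)   = *-cancelˡ (inv-≢0 x≢0)
      (trans (*-inv (inv-≢0 x≢0)) (sym (trans (*-comm (inv x) x) (*-inv x≢0))))

  scale : ∀ {x} → x ≢ 0# → Carrier ↔ Carrier
  scale {x} x≢0 = mk↔ₛ′ (x *_) (inv x *_)
    (λ y → trans (sym (*-assoc x (inv x) y)) (trans (cong (_* y) (*-inv x≢0)) (*-identityˡ y)))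
    (λ y → trans (sym (*-assoc (inv x) x y)) (trans (cong (_* y) (trans (*-comm (inv x) x) (*-inv x≢0))) (*-identityˡ y)))

  translate : Carrier → Carrier ↔ Carrier
  translate x = mk↔ₛ′ (_+ x) (_- x) (//-rightDividesˡ x) (//-rightDividesʳ x)

  negation : Carrier ↔ Carrier
  negation = mk↔ₛ′ -_ -_ -‿involutive -‿involutive

  inversion : Carrier ↔ Carrier
  inversion = mk↔ₛ′ inv inv inv-involutive inv-involutive

  -- Products and sums over the whole field.

  module Π where
    open Reindexed enumeration (CommutativeRing.*-commutativeMonoid ring) public
      renaming (Σᴬ to Πᴬ; Σᴬ-bijection to Πᴬ-bijection; Σᴬ-single to Πᴬ-single)
    open MonoidSum (CommutativeRing.*-commutativeMonoid ring) public
  module Σ where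
    open Reindexed enumeration (CommutativeRing.+-commutativeMonoid ring) public
    open MonoidSum (CommutativeRing.+-commutativeMonoid ring) public
  open Π using (Πᴬ)
  open Mult (CommutativeRing.+-monoid ring) using () renaming (_×_ to _·_; ×-assocˡ to ·-assocˡ)

  product-≢0 : ∀ {n} {f : Fin n → Carrier} → (∀ i → f i ≢ 0#) → Π.sum f ≢ 0#
  product-≢0 {zero}  f≢0 = 0≢1 ∘ sym
  product-≢0 {suc n} f≢0 = *-≢0 (f≢0 zero) (product-≢0 (f≢0 ∘ suc))

  -- Multiplying every nonzero y by x permutes the nonzero elements; the factor 1
  -- standing for y = 0 is the one scaled back by ψ.
  x^q≡x : ∀ x → x ≢ 0# → x ^ q ≡ x
  x^q≡x x x≢0 = *-cancelˡ P≢0 (begin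
    P * x ^ q                ≡⟨ *-comm P _ ⟩
    x ^ q * P                ≡⟨ cong (_* P) (Π.sum-replicate q {x}) ⟨
    Πᴬ (λ _ → x) * P         ≡⟨ Π.∑-distrib-+ (λ _ → x) (g ∘ from) ⟨
    Πᴬ (λ y → x * g y)       ≡⟨ Π.sum-cong-≗ (rescale ∘ from) ⟩
    Πᴬ (λ y → ψ y * g (x * y))  ≡⟨ Π.∑-distrib-+ (ψ ∘ from) (λ i → g (x * from i)) ⟩
    Πᴬ ψ * Πᴬ (g ∘ (x *_))   ≡⟨ cong₂ _*_ (Π.Πᴬ-single ψ 0# ψ-≢) (Π.Πᴬ-bijection g (scale x≢0)) ⟩
    ψ 0# * P                 ≡⟨ cong (_* P) ψ-0 ⟩
    x * P                    ≡⟨ *-comm x P ⟩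
    P * x                    ∎)
    where
    g ψ : Carrier → Carrier
    g y with y ≟ 0#
    ... | yes _ = 1#
    ... | no  _ = y
    ψ y with y ≟ 0#
    ... | yes _ = x
    ... | no  _ = 1#
    P : Carrier
    P = Πᴬ g
    g≢0 : ∀ y → g y ≢ 0#
    g≢0 y with y ≟ 0#
    ... | yes _  = 0≢1 ∘ sym
    ... | no y≢0 = y≢0
    P≢0 : P ≢ 0#
    P≢0 = product-≢0 (g≢0 ∘ from)
    ψ-0 : ψ 0# ≡ x
    ψ-0 with 0# ≟ 0#
    ... | yes _  = refl
    ... | no 0≢0 = contradiction refl 0≢0
    ψ-≢ : ∀ y → y ≢ 0# → ψ y ≡ 1#
    ψ-≢ y y≢0 with y ≟ 0#
    ... | yes y≡0 = contradiction y≡0 y≢0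
    ... | no _    = refl
    rescale : ∀ y → x * g y ≡ ψ y * g (x * y)
    rescale y with y ≟ 0# | x * y ≟ 0#
    ... | yes refl | yes _   = refl
    ... | yes refl | no x0≢0 = contradiction (zeroʳ x) x0≢0
    ... | no y≢0   | yes xy≡0 = contradiction xy≡0 (*-≢0 x≢0 y≢0)
    ... | no _     | no _     = sym (*-identityˡ (x * y))

  -- Translation by 1 permutes the field, so adding 1 to each of the `q` elements leaves their total
  -- `S` unchanged.
  q·1≡0 : q · 1# ≡ 0#
  q·1≡0 = +-cancelʳ S (q · 1#) 0# (begin
    q · 1# + S                   ≡⟨ cong (_+ S) (Σ.sum-replicate q {1#}) ⟨
    Σ.Σᴬ (λ _ → 1#) + S          ≡⟨ Σ.∑-distrib-+ (λ _ → 1#) from ⟨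
    Σ.Σᴬ (1# +_)                 ≡⟨ Σ.sum-cong-≗ (λ i → +-comm 1# (from i)) ⟩
    Σ.Σᴬ (_+ 1#)                 ≡⟨ Σ.Σᴬ-bijection (λ x → x) (translate 1#) ⟩
    S                            ≡⟨ +-identityˡ S ⟨
    0# + S                       ∎)
    where
    S : Carrier
    S = Σ.Σᴬ (λ x → x)

  SquareNZ : Carrier → Set
  SquareNZ = IsNonzeroSquare F

  square-* : ∀ {x y} → SquareNZ x → SquareNZ y → SquareNZ (x * y)
  square-* (x≢0 , s , refl) (y≢0 , r , refl) = *-≢0 x≢0 y≢0 , s * r , *-interchange s r s r

  -- The product of `y - 1` and `y + 1` vanishes, and for `y ≢ 1#` the first factor cancels.
  y²≡1⇒y≡±1 : ∀ {y} → y * y ≡ 1# → y ≡ 1# ⊎ y ≡ - 1#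
  y²≡1⇒y≡±1 {y} y²≡1 with y ≟ 1#
  ... | yes y≡1 = inj₁ y≡1
  ... | no y≢1  = inj₂ (+-inverseˡ-unique y 1# (*-cancelˡ (λ e → y≢1 (x∙y⁻¹≈ε⇒x≈y y 1# e)) (begin
    (y - 1#) * (y + 1#)              ≡⟨ distribʳ (y + 1#) y (- 1#) ⟩
    y * (y + 1#) + - 1# * (y + 1#)   ≡⟨ cong₂ _+_ (distribˡ y y 1#) (-1*x≈-x (y + 1#)) ⟩
    (y * y + y * 1#) - (y + 1#)      ≡⟨ cong (_- (y + 1#)) (trans (cong₂ _+_ y²≡1 (*-identityʳ y)) (+-comm 1# y)) ⟩
    (y + 1#) - (y + 1#)              ≡⟨ -‿inverseʳ (y + 1#) ⟩
    0#                               ≡⟨ zeroʳ (y - 1#) ⟨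
    (y - 1#) * 0#                    ∎)))

  -- Euler's criterion for `q ≡ 3` modulo 4.

  module Mod4 (q%4≡3 : q ℕ.% 4 ≡ 3) where

    -- With `q = 4m + 3`, `h = 2m + 1 = (q - 1)/2` is Euler's exponent, visibly odd, and
    -- `suc m = (q + 1)/4`.
    m h : ℕ
    m = q ℕ./ 4
    h = suc (m ℕ.* 2)

    q≡1+h*2 : q ≡ suc (h ℕ.* 2)
    q≡1+h*2 = trans (m≡m%n+[m/n]*n q 4) (trans (cong (ℕ._+ m ℕ.* 4) q%4≡3) (lem m))
      where
      lem : ∀ m → 3 ℕ.+ m ℕ.* 4 ≡ suc (suc (m ℕ.* 2) ℕ.* 2)
      lem = solve-∀

    -- As `q` is odd, `2 · 1# ≡ 0#` would reduce `q · 1#` to `1#`, but it is `0#`.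
    1≢-1 : 1# ≢ - 1#
    1≢-1 1≡-1 = 0≢1 (sym (begin
      1#                    ≡⟨ +-identityʳ 1# ⟨
      1# + 0#               ≡⟨ cong (1# +_) (Σ.sum-replicate-zero h) ⟨
      1# + Σ.sum {h} (λ _ → 0#)  ≡⟨ cong (1# +_) (Σ.sum-replicate h) ⟩
      1# + h · 0#           ≡⟨ cong (λ z → 1# + h · z) 2·1≡0 ⟨
      1# + h · (2 · 1#)     ≡⟨ cong (1# +_) (·-assocˡ 1# h 2) ⟩
      suc (h ℕ.* 2) · 1#    ≡⟨ cong (_· 1#) q≡1+h*2 ⟨
      q · 1#                ≡⟨ q·1≡0 ⟩
      0#                    ∎))
      where
      2·1≡0 : 2 · 1# ≡ 0#
      2·1≡0 = trans (cong (1# +_) (+-identityʳ 1#)) (trans (cong (_+ 1#) 1≡-1) (-‿inverseˡ 1#))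

    x^[h*2]≡1 : ∀ {x} → x ≢ 0# → x ^ (h ℕ.* 2) ≡ 1#
    x^[h*2]≡1 {x} x≢0 = *-cancelˡ x≢0 (begin
      x ^ suc (h ℕ.* 2)  ≡⟨ cong (x ^_) q≡1+h*2 ⟨
      x ^ q              ≡⟨ x^q≡x x x≢0 ⟩
      x                  ≡⟨ *-identityʳ x ⟨
      x * 1#             ∎)

    x^2≡x*x : ∀ x → x ^ 2 ≡ x * x
    x^2≡x*x x = cong (x *_) (*-identityʳ x)

    x^h≡±1 : ∀ {x} → x ≢ 0# → x ^ h ≡ 1# ⊎ x ^ h ≡ - 1#
    x^h≡±1 {x} x≢0 = y²≡1⇒y≡±1 (trans (sym (x^2≡x*x (x ^ h))) (trans (^-assocʳ x h 2) (x^[h*2]≡1 x≢0)))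

    -- `suc m * 2` computes to `suc h`. As `x ^ h` is 1 or -1 for nonzero `x`, this makes
    -- `x ^ suc m` an explicit square root of `x` or of `- x`.
    root : ∀ x → x ^ suc m * x ^ suc m ≡ x * x ^ h
    root x = trans (sym (x^2≡x*x (x ^ suc m))) (^-assocʳ x (suc m) 2)

    nonzero-square-dichotomy : ∀ {x} → x ≢ 0# → SquareNZ x ⊎ SquareNZ (- x)
    nonzero-square-dichotomy {x} x≢0 with x^h≡±1 x≢0
    ... | inj₁ e = inj₁ (x≢0 , x ^ suc m , trans (root x) (trans (cong (x *_) e) (*-identityʳ x)))
    ... | inj₂ e = inj₂ (-‿≢0 x≢0 , x ^ suc m , trans (root x) (trans (cong (x *_) e)
                     (trans (*-comm x (- 1#)) (-1*x≈-x x))))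

    square^h : ∀ {x} → SquareNZ x → x ^ h ≡ 1#
    square^h {x} (x≢0 , s , s²≡x) = begin
      x ^ h          ≡⟨ cong (_^ h) (trans (sym s²≡x) (sym (x^2≡x*x s))) ⟩
      (s ^ 2) ^ h    ≡⟨ ^-assocʳ s 2 h ⟩
      s ^ (2 ℕ.* h)  ≡⟨ cong (s ^_) (ℕ.*-comm 2 h) ⟩
      s ^ (h ℕ.* 2)  ≡⟨ x^[h*2]≡1 s≢0 ⟩
      1#             ∎
      where
      s≢0 : s ≢ 0#
      s≢0 refl = x≢0 (trans (sym s²≡x) (zeroˡ 0#))

    1^n≡1 : ∀ n → 1# ^ n ≡ 1#
    1^n≡1 n = trans (sym (Π.sum-replicate n {1#})) (Π.sum-replicate-zero n)

    -- Both `h`-th powers would be 1, yet they differ by the factor `(- 1#) ^ h`, which is -1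
    -- because `h` is odd.
    square-asym : ∀ {x} → SquareNZ x → ¬ SquareNZ (- x)
    square-asym {x} sq sq⁻ = 1≢-1 (begin
      1#                     ≡⟨ square^h sq⁻ ⟨
      (- x) ^ h              ≡⟨ cong (_^ h) (-1*x≈-x x) ⟨
      (- 1# * x) ^ h         ≡⟨ ^-distrib-* (- 1#) x h ⟩
      (- 1#) ^ h * x ^ h     ≡⟨ cong₂ _*_ -1^h≡-1 (square^h sq) ⟩
      - 1# * 1#              ≡⟨ *-identityʳ (- 1#) ⟩
      - 1#                   ∎)
      where
      -1^2≡1 : (- 1#) ^ 2 ≡ 1#
      -1^2≡1 = trans (x^2≡x*x (- 1#)) (trans (-1*x≈-x (- 1#)) (-‿involutive 1#))
      -1^h≡-1 : (- 1#) ^ h ≡ - 1#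
      -1^h≡-1 = begin
        - 1# * (- 1#) ^ (m ℕ.* 2)    ≡⟨ cong (λ e → - 1# * (- 1#) ^ e) (ℕ.*-comm m 2) ⟩
        - 1# * (- 1#) ^ (2 ℕ.* m)    ≡⟨ cong (- 1# *_) (^-assocʳ (- 1#) 2 m) ⟨
        - 1# * ((- 1#) ^ 2) ^ m      ≡⟨ cong (λ z → - 1# * z ^ m) -1^2≡1 ⟩
        - 1# * 1# ^ m                ≡⟨ cong (- 1# *_) (1^n≡1 m) ⟩
        - 1# * 1#                    ≡⟨ *-identityʳ (- 1#) ⟩
        - 1#                         ∎

-- Integer sums and squares.

open import Data.Integer as ℤ using (ℤ; 0ℤ; 1ℤ; -1ℤ; +_; -[1+_]; +≤+)
import Data.Integer.Properties as ℤ

module ℤΣ = SemiringSum ℤ.+-*-semiring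

sumℤ-mono-≤ : ∀ {n} {f g : Fin n → ℤ} → (∀ i → f i ℤ.≤ g i) → ℤΣ.sum f ℤ.≤ ℤΣ.sum g
sumℤ-mono-≤ {zero}  f≤g = ℤ.≤-refl
sumℤ-mono-≤ {suc n} f≤g = ℤ.+-mono-≤ (f≤g zero) (sumℤ-mono-≤ (f≤g ∘ suc))

sum-pos : ∀ {n} (f : Fin n → ℕ) → ℤΣ.sum (+_ ∘ f) ≡ + ℕΣ.sum f
sum-pos {zero}  f = refl
sum-pos {suc n} f = cong (ℤ._+_ (+ f zero)) (sum-pos (f ∘ suc))

square-nonneg : ∀ i → 0ℤ ℤ.≤ i ℤ.* i
square-nonneg (+ n)    = subst (0ℤ ℤ.≤_) (ℤ.pos-* n n) (+≤+ ℕ.z≤n)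
square-nonneg -[1+ n ] = +≤+ ℕ.z≤n

i≡-i⇒i≡0 : ∀ {i} → i ≡ ℤ.- i → i ≡ 0ℤ
i≡-i⇒i≡0 {+ zero} _ = refl

square-sum : ∀ {n} (f : Fin n → ℤ) →
             ℤΣ.sum f ℤ.* ℤΣ.sum f ≡ ℤΣ.sum λ i → ℤΣ.sum λ j → f i ℤ.* f j
square-sum f = trans (ℤΣ.*-distribʳ-sum (ℤΣ.sum f) f) (ℤΣ.sum-cong-≗ λ i → ℤΣ.*-distribˡ-sum (f i) f)

does⇒ : ∀ {P : Set} (P? : Dec P) → does P? ≡ true → P
does⇒ (yes p) _ = p

-- The quadratic character and its correlations.

module Character {q : ℕ} (F : FiniteField q) (q%4≡3 : q ℕ.% 4 ≡ 3) where
  open Field F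
  open Mod4 q%4≡3
  open Reindexed enumeration (Semiring.+-commutativeMonoid ℤ.+-*-semiring) using (Σᴬ; Σᴬ-bijection; Σᴬ-single)
  open CommutativeSemigroupProperties ℤ.*-commutativeSemigroup
    using () renaming (interchange to ℤ-interchange)
  open ≡-Reasoning

  -- The graph of the quadratic character. A nonsquare is certified positively, by a square root of
  -- `- x`, so that negation merely exchanges the last two constructors.
  data Residue (x : Carrier) : ℤ → Set where
    zero      : x ≡ 0# → Residue x 0ℤ
    square    : SquareNZ x → Residue x 1ℤ
    nonsquare : SquareNZ (- x) → Residue x -1ℤ

  residue : ∀ x → ∃ (Residue x)
  residue x with x ≟ 0#
  ... | yes x≡0 = _ , zero x≡0
  ... | no x≢0 with nonzero-square-dichotomy x≢0
  ... | inj₁ sq = _ , square sq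
  ... | inj₂ sq = _ , nonsquare sq

  -- The relation is functional, so a value of `χ` can be computed by exhibiting any `Residue`
  -- witness.
  residue-unique : ∀ {x a b} → Residue x a → Residue x b → a ≡ b
  residue-unique (zero _)        (zero _)        = refl
  residue-unique (square _)      (square _)      = refl
  residue-unique (nonsquare _)   (nonsquare _)   = refl
  residue-unique (zero e)        (square sq)     = contradiction e (proj₁ sq)
  residue-unique (square sq)     (zero e)        = contradiction e (proj₁ sq)
  residue-unique (square sq)     (nonsquare sq⁻) = contradiction sq⁻ (square-asym sq)
  residue-unique (nonsquare sq⁻) (square sq)     = contradiction sq⁻ (square-asym sq)
  residue-unique (zero refl)     (nonsquare sq⁻) = contradiction -0#≈0# (proj₁ sq⁻)
  residue-unique (nonsquare sq⁻) (zero refl)     = contradiction -0#≈0# (proj₁ sq⁻)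

  residue-neg : ∀ {x a} → Residue x a → Residue (- x) (ℤ.- a)
  residue-neg (zero refl)    = zero -0#≈0#
  residue-neg (square sq)    = nonsquare (subst SquareNZ (sym (-‿involutive _)) sq)
  residue-neg (nonsquare sq) = square sq

  residue-* : ∀ {x y a b} → Residue x a → Residue y b → Residue (x * y) (a ℤ.* b)
  residue-* {y = y} (zero refl) _ = zero (zeroˡ y)
  residue-* {x} {a = a} _ (zero refl) = subst (Residue (x * 0#)) (sym (ℤ.*-zeroʳ a)) (zero (zeroʳ x))
  residue-* (square s) (square r) = square (square-* s r)
  residue-* {x} {y} (square s) (nonsquare r) = nonsquare (subst SquareNZ (sym (-‿distribʳ-* x y)) (square-* s r))
  residue-* {x} {y} (nonsquare s) (square r) = nonsquare (subst SquareNZ (sym (-‿distribˡ-* x y)) (square-* s r))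
  residue-* {x} {y} (nonsquare s) (nonsquare r) = square (subst SquareNZ (begin
    - x * - y      ≡⟨ -‿distribˡ-* x (- y) ⟨
    - (x * - y)    ≡⟨ cong -_ (-‿distribʳ-* x y) ⟨
    - - (x * y)    ≡⟨ -‿involutive (x * y) ⟩
    x * y          ∎) (square-* s r))

  χ : Carrier → ℤ
  χ x = proj₁ (residue x)

  χ≡ : ∀ {x a} → Residue x a → χ x ≡ a
  χ≡ {x} = residue-unique (proj₂ (residue x))

  χ-neg : ∀ x → χ (- x) ≡ ℤ.- χ x
  χ-neg x = χ≡ (residue-neg (proj₂ (residue x)))

  χ-* : ∀ x y → χ (x * y) ≡ χ x ℤ.* χ y
  χ-* x y = χ≡ (residue-* (proj₂ (residue x)) (proj₂ (residue y)))

  χ-square : ∀ {x} → x ≢ 0# → χ x ℤ.* χ x ≡ 1ℤ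
  χ-square {x} x≢0 = trans (sym (χ-* x x)) (χ≡ (square (*-≢0 x≢0 x≢0 , x , refl)))

  χ-1 : χ 1# ≡ 1ℤ
  χ-1 = χ≡ (square (0≢1 ∘ sym , 1# , *-identityˡ 1#))

  Σ-neg : ∀ {n} (f : Fin n → ℤ) → ℤΣ.sum (ℤ.-_ ∘ f) ≡ ℤ.- ℤΣ.sum f
  Σ-neg {zero}  f = refl
  Σ-neg {suc n} f = trans (cong (λ z → ℤ.- f zero ℤ.+ z) (Σ-neg (f ∘ suc))) (sym (ℤ.neg-distrib-+ (f zero) _))

  -- Negation permutes the field and reverses the sign of `χ`, so the sum equals its own negative.
  Σχ≡0 : Σᴬ χ ≡ 0ℤ
  Σχ≡0 = i≡-i⇒i≡0 (begin
    Σᴬ χ              ≡⟨ Σᴬ-bijection χ negation ⟨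
    Σᴬ (χ ∘ -_)       ≡⟨ ℤΣ.sum-cong-≗ (χ-neg ∘ from) ⟩
    Σᴬ (ℤ.-_ ∘ χ)     ≡⟨ Σ-neg (χ ∘ from) ⟩
    ℤ.- Σᴬ χ          ∎)

  -- A correction at the single point `y = 0`, where a product containing `χ y` vanishes; it lets
  -- the substitution by `inv` run over the whole field.
  at-0 : Carrier → ℤ
  at-0 y with y ≟ 0#
  ... | yes _ = 1ℤ
  ... | no  _ = 0ℤ

  at-0-0 : at-0 0# ≡ 1ℤ
  at-0-0 with 0# ≟ 0#
  ... | yes _  = refl
  ... | no 0≢0 = contradiction refl 0≢0

  at-0-≢ : ∀ x → x ≢ 0# → at-0 x ≡ 0ℤ
  at-0-≢ x x≢0 with x ≟ 0#
  ... | yes x≡0 = contradiction x≡0 x≢0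
  ... | no _    = refl

  Σ-at-0 : Σᴬ at-0 ≡ 1ℤ
  Σ-at-0 = trans (Σᴬ-single at-0 0# at-0-≢) at-0-0

  -- For y ≠ 0, χ(y)χ(y + c) = χ(y)²χ(c/y + 1). Since inv 0# ≡ 0#, the right side is χ(1) at y = 0.
  χ-shift : ∀ c y → χ y ℤ.* χ (y + c) ℤ.+ at-0 y ≡ χ (c * inv y + 1#)
  χ-shift c y = shift (y ≟ 0#)
    where
    shift : Dec (y ≡ 0#) → χ y ℤ.* χ (y + c) ℤ.+ at-0 y ≡ χ (c * inv y + 1#)
    shift (yes refl) = begin
      χ 0# ℤ.* χ (0# + c) ℤ.+ at-0 0#  ≡⟨ cong₂ (λ z w → z ℤ.* χ (0# + c) ℤ.+ w) (χ≡ (zero refl)) at-0-0 ⟩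
      1ℤ                           ≡⟨ χ-1 ⟨
      χ 1#                         ≡⟨ cong χ (+-identityˡ 1#) ⟨
      χ (0# + 1#)                  ≡⟨ cong (λ z → χ (z + 1#)) (zeroʳ c) ⟨
      χ (c * 0# + 1#)              ≡⟨ cong (λ z → χ (c * z + 1#)) inv-0 ⟨
      χ (c * inv 0# + 1#)          ∎
    shift (no y≢0) = begin
      χ y ℤ.* χ (y + c) ℤ.+ at-0 y ≡⟨ cong (ℤ._+_ (χ y ℤ.* χ (y + c))) (at-0-≢ y y≢0) ⟩
      χ y ℤ.* χ (y + c) ℤ.+ 0ℤ     ≡⟨ ℤ.+-identityʳ _ ⟩
      χ y ℤ.* χ (y + c)            ≡⟨ cong (λ z → χ y ℤ.* χ z) y+c≡ ⟩
      χ y ℤ.* χ (y * w)            ≡⟨ cong (χ y ℤ.*_) (χ-* y w) ⟩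
      χ y ℤ.* (χ y ℤ.* χ w)        ≡⟨ ℤ.*-assoc (χ y) (χ y) (χ w) ⟨
      χ y ℤ.* χ y ℤ.* χ w          ≡⟨ cong (ℤ._* χ w) (χ-square y≢0) ⟩
      1ℤ ℤ.* χ w                   ≡⟨ ℤ.*-identityˡ (χ w) ⟩
      χ w                          ∎
      where
      w : Carrier
      w = c * inv y + 1#
      y+c≡ : y + c ≡ y * w
      y+c≡ = begin
        y + c                        ≡⟨ +-comm y c ⟩
        c + y                        ≡⟨ cong₂ _+_ (*-identityʳ c) (*-identityʳ y) ⟨
        c * 1# + y * 1#              ≡⟨ cong (λ z → c * z + y * 1#) (*-inv y≢0) ⟨
        c * (y * inv y) + y * 1#     ≡⟨ cong (_+ y * 1#) (trans (sym (*-assoc c y _))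
                                       (trans (cong (_* inv y) (*-comm c y)) (*-assoc y c _))) ⟩
        y * (c * inv y) + y * 1#     ≡⟨ distribˡ y (c * inv y) 1# ⟨
        y * w                        ∎

  autocorrelation : Carrier → ℤ
  autocorrelation c = Σᴬ λ y → χ y ℤ.* χ (y + c)

  -- This is `χ-shift` summed over the field; the extra 1 is the total of `at-0`.
  autocorrelation+1 : ∀ c → autocorrelation c ℤ.+ 1ℤ ≡ Σᴬ λ y → χ (c * inv y + 1#)
  autocorrelation+1 c = begin
    autocorrelation c ℤ.+ 1ℤ       ≡⟨ cong (ℤ._+_ (autocorrelation c)) Σ-at-0 ⟨
    autocorrelation c ℤ.+ Σᴬ at-0  ≡⟨ ℤΣ.∑-distrib-+ (λ i → χ (from i) ℤ.* χ (from i + c)) (at-0 ∘ from) ⟨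
    Σᴬ (λ y → χ y ℤ.* χ (y + c) ℤ.+ at-0 y) ≡⟨ ℤΣ.sum-cong-≗ (χ-shift c ∘ from) ⟩
    Σᴬ (λ y → χ (c * inv y + 1#))  ∎

  autocorrelation-0 : autocorrelation 0# ℤ.+ 1ℤ ≡ + q
  autocorrelation-0 = begin
    autocorrelation 0# ℤ.+ 1ℤ        ≡⟨ autocorrelation+1 0# ⟩
    Σᴬ (λ y → χ (0# * inv y + 1#))   ≡⟨ ℤΣ.sum-cong-≗ (λ i → trans
                                          (cong χ (trans (cong (_+ 1#) (zeroˡ (inv (from i)))) (+-identityˡ 1#))) χ-1) ⟩
    Σᴬ (λ _ → 1ℤ)                    ≡⟨ sum-pos {q} (λ _ → 1) ⟩
    + ℕΣ.sum {q} (λ _ → 1)           ≡⟨ cong +_ (trans (sum-const q 1) (ℕ.*-identityʳ q)) ⟩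
    + q                              ∎

  -- For `c ≢ 0#` the map from `y` to `c * inv y + 1#` is a composite of three bijections, so the
  -- sum collapses to that of `χ`.
  autocorrelation-≢0 : ∀ {c} → c ≢ 0# → autocorrelation c ℤ.+ 1ℤ ≡ 0ℤ
  autocorrelation-≢0 {c} c≢0 = begin
    autocorrelation c ℤ.+ 1ℤ        ≡⟨ autocorrelation+1 c ⟩
    Σᴬ (λ y → χ (c * inv y + 1#))   ≡⟨ Σᴬ-bijection (λ y → χ (c * y + 1#)) inversion ⟩
    Σᴬ (λ y → χ (c * y + 1#))       ≡⟨ Σᴬ-bijection (λ y → χ (y + 1#)) (scale c≢0) ⟩
    Σᴬ (λ y → χ (y + 1#))           ≡⟨ Σᴬ-bijection χ (translate 1#) ⟩
    Σᴬ χ                            ≡⟨ Σχ≡0 ⟩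
    0ℤ                              ∎

  correlation : Carrier → Carrier → ℤ
  correlation b b′ = Σᴬ λ x → χ (b - x) ℤ.* χ (b′ - x)

  -- Substitute `y = b - x`, as a negation followed by a translation; then `b′ - x` becomes
  -- `y + (b′ - b)`.
  correlation≡ : ∀ b b′ → correlation b b′ ≡ autocorrelation (b′ - b)
  correlation≡ b b′ = begin
    correlation b b′              ≡⟨ ℤΣ.sum-cong-≗ (λ i → cong₂ (λ y z → χ y ℤ.* χ z) (+-comm b (- from i)) (shift (from i))) ⟩
    Σᴬ (λ x → f (- x + b))        ≡⟨ Σᴬ-bijection (λ x → f (x + b)) negation ⟩
    Σᴬ (λ x → f (x + b))          ≡⟨ Σᴬ-bijection f (translate b) ⟩
    autocorrelation (b′ - b)      ∎
    where
    f : Carrier → ℤ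
    f y = χ y ℤ.* χ (y + (b′ - b))
    shift : ∀ x → b′ - x ≡ - x + b + (b′ - b)
    shift x = begin
      b′ - x                  ≡⟨ +-comm b′ (- x) ⟩
      - x + b′                ≡⟨ cong (_+_ (- x)) (//-rightDividesˡ b b′) ⟨
      - x + ((b′ - b) + b)    ≡⟨ cong (_+_ (- x)) (+-comm (b′ - b) b) ⟩
      - x + (b + (b′ - b))    ≡⟨ +-assoc (- x) b (b′ - b) ⟨
      - x + b + (b′ - b)      ∎

  from-injective : ∀ {i j} → from i ≡ from j → i ≡ j
  from-injective {i} {j} e = trans (sym (strictlyInverseˡ i)) (trans (cong to e) (strictlyInverseˡ j))

  -- The exact values are `q - 1` on the diagonal and -1 off it; raising both by 1 gives a bound
  -- expressible through `δ`.
  correlation≤ : ∀ i j → correlation (from i) (from j) ℤ.≤ + (δ i j ℕ.* q)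
  correlation≤ i j = by-cases (i Fin.≟ j)
    where
    bound : ∀ {c} → autocorrelation (from j - from i) ℤ.+ 1ℤ ≡ c → correlation (from i) (from j) ℤ.≤ c
    bound e = ℤ.≤-trans (ℤ.≤-reflexive (correlation≡ (from i) (from j)))
      (ℤ.≤-trans (ℤ.i≤i+j _ 1ℤ) (ℤ.≤-reflexive e))
    by-cases : Dec (i ≡ j) → correlation (from i) (from j) ℤ.≤ + (δ i j ℕ.* q)
    by-cases (yes refl) = bound (trans (cong (λ c → autocorrelation c ℤ.+ 1ℤ) (-‿inverseʳ (from i)))
      (trans autocorrelation-0 (cong +_ (sym (trans (cong (ℕ._* q) (δ-refl i)) (ℕ.*-identityˡ q))))))
    by-cases (no i≢j) = bound (trans
      (autocorrelation-≢0 (λ e → i≢j (sym (from-injective (x∙y⁻¹≈ε⇒x≈y (from j) (from i) e)))))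
      (cong (λ d → + (d ℕ.* q)) (sym (δ-≢ i≢j))))

  -- The bound for two vertex sets with all edges directed from one to the other.

  module _ (A B : Fin q → Bool)
           (A→B : ∀ i j → A i ≡ true → B j ≡ true → PaleyEdge F (from i) (from j)) where
    open PairSum B using () renaming (τ to β; pairSum to pairSumᴮ; pairSum-rows to pairSumᴮ-rows)

    summand : Fin q → Fin q → ℤ
    summand i j = + β j ℤ.* χ (from j - from i)

    -- The number of out-neighbours of `i` in `B` minus the number of its in-neighbours in `B`.
    excess : Fin q → ℤ
    excess i = ℤΣ.sum (summand i)

    excess-A : ∀ i → A i ≡ true → excess i ≡ + count B
    excess-A i Ai = trans (ℤΣ.sum-cong-≗ term) (sum-pos β)
      where
      term : ∀ j → summand i j ≡ + β j
      term j with B j in Bj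
      ... | true  = trans (ℤ.*-identityˡ _) (χ≡ (square (A→B i j Ai Bj)))
      ... | false = refl

    -- Each `i` in `A` has excess exactly `count B`, and all other squares are nonnegative.
    excess²-lower : + (count A ℕ.* (count B ℕ.* count B)) ℤ.≤ ℤΣ.sum λ i → excess i ℤ.* excess i
    excess²-lower = subst (λ z → z ℤ.≤ ℤΣ.sum λ i → excess i ℤ.* excess i) eq (sumℤ-mono-≤ term)
      where
      b² : ℕ
      b² = count B ℕ.* count B
      eq : ℤΣ.sum (λ i → + (⟦ A i ⟧ ℕ.* b²)) ≡ + (count A ℕ.* b²)
      eq = trans (sum-pos (λ i → ⟦ A i ⟧ ℕ.* b²)) (cong +_ (sym (ℕΣ.*-distribʳ-sum b² (⟦_⟧ ∘ A))))
      term : ∀ i → + (⟦ A i ⟧ ℕ.* b²) ℤ.≤ excess i ℤ.* excess i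
      term i with A i in Ai
      ... | true  = ℤ.≤-reflexive (begin
        + (b² ℕ.+ 0)               ≡⟨ cong +_ (ℕ.+-identityʳ b²) ⟩
        + b²                       ≡⟨ ℤ.pos-* (count B) (count B) ⟩
        + count B ℤ.* + count B    ≡⟨ cong₂ ℤ._*_ (excess-A i Ai) (excess-A i Ai) ⟨
        excess i ℤ.* excess i      ∎)
      ... | false = square-nonneg (excess i)

    -- After expanding the square, the sum over `i` is moved innermost, where it becomes a
    -- correlation of two members of `B`.
    excess²-expand : (ℤΣ.sum λ i → excess i ℤ.* excess i) ≡
                     ℤΣ.sum λ j → ℤΣ.sum λ k → + (β j ℕ.* β k) ℤ.* correlation (from j) (from k)
    excess²-expand = begin
      (ℤΣ.sum λ i → excess i ℤ.* excess i)
        ≡⟨ ℤΣ.sum-cong-≗ (λ i → square-sum (summand i)) ⟩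
      (ℤΣ.sum λ i → ℤΣ.sum λ j → ℤΣ.sum λ k → summand i j ℤ.* summand i k)
        ≡⟨ ℤΣ.∑-comm (λ i j → ℤΣ.sum λ k → summand i j ℤ.* summand i k) ⟩
      (ℤΣ.sum λ j → ℤΣ.sum λ i → ℤΣ.sum λ k → summand i j ℤ.* summand i k)
        ≡⟨ ℤΣ.sum-cong-≗ (λ j → ℤΣ.∑-comm (λ i k → summand i j ℤ.* summand i k)) ⟩
      (ℤΣ.sum λ j → ℤΣ.sum λ k → ℤΣ.sum λ i → summand i j ℤ.* summand i k)
        ≡⟨ ℤΣ.sum-cong-≗ (λ j → ℤΣ.sum-cong-≗ (λ k → trans (ℤΣ.sum-cong-≗ (term j k))
             (sym (ℤΣ.*-distribˡ-sum (+ (β j ℕ.* β k)) (λ i → χ (from j - from i) ℤ.* χ (from k - from i)))))) ⟩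
      (ℤΣ.sum λ j → ℤΣ.sum λ k → + (β j ℕ.* β k) ℤ.* correlation (from j) (from k)) ∎
      where
      term : ∀ j k i → summand i j ℤ.* summand i k ≡
                       + (β j ℕ.* β k) ℤ.* (χ (from j - from i) ℤ.* χ (from k - from i))
      term j k i = trans (ℤ-interchange (+ β j) _ (+ β k) _) (cong (ℤ._* _) (sym (ℤ.pos-* (β j) (β k))))

    -- By the correlation bound only the diagonal pairs of `B` remain, each contributing at most
    -- `q`.
    excess²-upper : (ℤΣ.sum λ i → excess i ℤ.* excess i) ℤ.≤ + (count B ℕ.* q)
    excess²-upper = R.begin
      (ℤΣ.sum λ i → excess i ℤ.* excess i)
        R.≡⟨ excess²-expand ⟩
      (ℤΣ.sum λ j → ℤΣ.sum λ k → + (β j ℕ.* β k) ℤ.* correlation (from j) (from k))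
        R.≤⟨ sumℤ-mono-≤ (λ j → sumℤ-mono-≤ λ k → ℤ.*-monoˡ-≤-nonNeg (+ (β j ℕ.* β k)) (correlation≤ j k)) ⟩
      (ℤΣ.sum λ j → ℤΣ.sum λ k → + (β j ℕ.* β k) ℤ.* + (δ j k ℕ.* q))
        R.≡⟨ ℤΣ.sum-cong-≗ (λ j → trans (ℤΣ.sum-cong-≗ λ k → sym (ℤ.pos-* (β j ℕ.* β k) (δ j k ℕ.* q)))
               (sum-pos (λ k → β j ℕ.* β k ℕ.* (δ j k ℕ.* q)))) ⟩
      (ℤΣ.sum λ j → + ℕΣ.sum λ k → β j ℕ.* β k ℕ.* (δ j k ℕ.* q))
        R.≡⟨ sum-pos (λ j → ℕΣ.sum λ k → β j ℕ.* β k ℕ.* (δ j k ℕ.* q)) ⟩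
      + pairSumᴮ (λ j k → δ j k ℕ.* q)
        R.≤⟨ +≤+ (pairSumᴮ-rows (λ j k → δ j k ℕ.* q) rows) ⟩
      + (count B ℕ.* q) R.∎
      where
      module R = ℤ.≤-Reasoning
      rows : B ⊩ λ j → ℕΣ.sum (λ k → δ j k ℕ.* q) ℕ.≤ q
      rows j _ = ℕ.≤-reflexive (begin
        ℕΣ.sum (λ k → δ j k ℕ.* q)  ≡⟨ ℕΣ.*-distribʳ-sum q (δ j) ⟨
        ℕΣ.sum (δ j) ℕ.* q          ≡⟨ cong (ℕ._* q) (sum-δ j) ⟩
        1 ℕ.* q                     ≡⟨ ℕ.*-identityˡ q ⟩
        q                           ∎)

    count*count≤q : count A ℕ.* count B ℕ.≤ q
    count*count≤q = cancel (count A) (count B) (ℤ.drop‿+≤+ (ℤ.≤-trans excess²-lower excess²-upper))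
      where
      cancel : ∀ a b → a ℕ.* (b ℕ.* b) ℕ.≤ b ℕ.* q → a ℕ.* b ℕ.≤ q
      -- For empty `B` there is nothing to cancel, but the product is already zero.
      cancel a zero    _  = subst (ℕ._≤ q) (sym (ℕ.*-zeroʳ a)) ℕ.z≤n
      cancel a b@(suc _) le = ℕ.*-cancelˡ-≤ b (subst (ℕ._≤ b ℕ.* q)
        (trans (sym (ℕ.*-assoc a b b)) (ℕ.*-comm (a ℕ.* b) b)) le)

  -- Edges and colour classes of the tournament.

  edge? : ∀ x y → Dec (PaleyEdge F x y)
  edge? x y with residue (y - x)
  ... | _ , zero e        = no λ sq → proj₁ sq e
  ... | _ , square sq     = yes sq
  ... | _ , nonsquare sq⁻ = no λ sq → square-asym sq sq⁻

  edge-total : ∀ {x y} → x ≢ y → PaleyEdge F x y ⊎ PaleyEdge F y x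
  edge-total {x} {y} x≢y with nonzero-square-dichotomy (λ e → x≢y (sym (x∙y⁻¹≈ε⇒x≈y y x e)))
  ... | inj₁ sq  = inj₁ sq
  ... | inj₂ sq⁻ = inj₂ (subst SquareNZ (⁻¹-anti-homo-// y x) sq⁻)

  module Coloring {k} (col : Carrier → Carrier → Fin k) (transitive : IsTransitiveColoring F k col) where

    Arc : Fin k → Fin q → Fin q → Set
    Arc i u v = PaleyEdge F (from u) (from v) × col (from u) (from v) ≡ i

    arc? : ∀ i u v → Dec (Arc i u v)
    arc? i u v = edge? (from u) (from v) ×-dec (col (from u) (from v) Fin.≟ i)

    arc : Fin k → Fin q → Fin q → Bool
    arc i u v = does (arc? i u v)

    arc-sound : ∀ {i u v} → arc i u v ≡ true → Arc i u v
    arc-sound {i} {u} {v} = does⇒ (arc? i u v)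

    arc-complete : ∀ {i u v} → Arc i u v → ⟦ arc i u v ⟧ ≡ 1
    arc-complete {i} {u} {v} a = cong ⟦_⟧ (dec-true (arc? i u v) a)

    -- Transitivity through `v` makes every in-neighbour of colour `i` point to every out-neighbour
    -- of colour `i`, so the bound for two such sets applies.
    in*out≤q : ∀ i v → count (λ u → arc i u v) ℕ.* count (arc i v) ℕ.≤ q
    in*out≤q i v = count*count≤q (λ u → arc i u v) (arc i v) λ u w uv vw →
      let (edge-uv , col-uv) = arc-sound {i} uv
          (edge-vw , col-vw) = arc-sound {i} vw
      in proj₁ (transitive (from u) (from v) (from w) i edge-uv edge-vw col-uv col-vw)

    -- Distinct vertices are joined by an edge in some direction, which is counted under its own
    -- colour; equal ones are counted by `δ`.
    covers : ∀ u v → 1 ℕ.≤ δ u v ℕ.+ ℕΣ.sum λ i → ⟦ arc i u v ⟧ ℕ.+ ⟦ arc i v u ⟧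
    covers u v = cover (u Fin.≟ v)
      where
      both : Fin k → ℕ
      both i = ⟦ arc i u v ⟧ ℕ.+ ⟦ arc i v u ⟧
      via : ∀ i → 1 ℕ.≤ both i → 1 ℕ.≤ δ u v ℕ.+ ℕΣ.sum both
      via i le = ℕ.≤-trans le (ℕ.≤-trans (term≤sum both i) (ℕ.m≤n+m _ (δ u v)))
      cover : Dec (u ≡ v) → 1 ℕ.≤ δ u v ℕ.+ ℕΣ.sum both
      cover (yes refl) = ℕ.≤-trans (ℕ.≤-reflexive (sym (δ-refl u))) (ℕ.m≤m+n _ _)
      cover (no u≢v) with edge-total (u≢v ∘ from-injective)
      ... | inj₁ uv = via _ (ℕ.≤-trans (ℕ.≤-reflexive (sym (arc-complete (uv , refl)))) (ℕ.m≤m+n _ _))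
      ... | inj₂ vu = via _ (ℕ.≤-trans (ℕ.≤-reflexive (sym (arc-complete (vu , refl)))) (ℕ.m≤n+m _ _))

-- Combination of the character bound with the counting argument.

open Counting using (sparse-cover; no-sparse-class; floor-sqrt; small-factor)
open import Data.Nat using (ℕ; _≤_; _<_; _^_; _+_; _*_; _%_)

theorem3p5 : (k q : ℕ) → 1 ≤ k → IsPrimePower q → q % 4 ≡ 3 →
    (2 ^ (2 * k + 1)) ^ 2 < q →
    (F : FiniteField q) → ¬ HasTransitiveColoring F k
theorem3p5 k q 1≤k _ q%4≡3 M²<q F (col , transitive) =
  let open Character F q%4≡3
      open Coloring col transitive
      t , t²≤q , q<[1+t]² = floor-sqrt q
      -- Sparsity at each vertex and colour: the in- and out-degrees have product at most `q`, so
      -- one of them is at most `t`.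
      s , q≤2^k*s , s²≤ = sparse-cover k t (λ i u v → Counting.⟦ arc i u v ⟧) covers
        (λ i v → small-factor _ _ q<[1+t]² (in*out≤q i v))
  in no-sparse-class 1≤k M²<q t²≤q q<[1+t]² q≤2^k*s s²≤
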